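{- Let $T$ be a tree of order $n\geq 4$ with $\Delta(T)\geq 3$. Suppose there exists a linear order $u_0,u_1,\dots,u_{n-1}$ of the vertices of $T$ satisfying $0=c(u_0)<c(u_1)<\dots<c(u_{n-1})$, where $c$ is the mapping defined by $$c(u_0)=0,\qquad c(u_{i+1})=c(u_i)+n-1-\mathcal{L}(u_i)-\mathcal{L}(u_{i+1})-\varepsilon(T),\quad 0\leq i\leq n-2,$$ and such that: 1. $u_0=w$ and $u_{n-1}\in N(w)$ when $C(T)=\{w\}$; and $\{u_0,u_{n-1}\}=\{w,w'\}$ when $C(T)=\{w,w'\}$; 2. when $C(T)=\{w\}$, $u_i$ and $u_{i+1}$ are in different branches for all $1\leq i\leq n-2$; when $C(T)=\{w,w'\}$, $u_i$ and $u_{i+1}$ are in opposite branches for all $0\leq i\leq n-2$, where a central vertex is counted as lying on its own side (i.e. the path from $u_i$ to $u_{i+1}$ contains the edge $ww'$); 3. $D(u_i,u_{i+1})\leq n/2$ for $0\leq i\leq n-2$. Then $$hc(T)=(n-1)(n-1-\varepsilon(T))+\varepsilon'(T)-2\mathcal{L}(T).$$ Moreover, under these conditions the mapping $c$ above is an optimal hamiltonian coloring of $T$, i.e. a hamiltonian coloring whose maximum color equals $hc(T)$.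
   Context: For a connected graph $G$ of order $n$ (finite, simple), $D(u,v)$ denotes the detour distance between vertices $u,v$, i.e. the length of a longest $u,v$-path in $G$ (for a tree this is the ordinary distance). A hamiltonian coloring of $G$ is a map $c: V(G)\to\{0,1,2,\dots\}$ such that $D(u,v)+|c(u)-c(v)|\geq n-1$ for every two distinct vertices $u,v$. The value $hc(c)$ is the maximum color assigned by $c$, and the hamiltonian chromatic number $hc(G)$ is the minimum of $hc(c)$ over all hamiltonian colorings $c$ of $G$ (note that the color $0$ is allowed). For a tree $T$, the center $C(T)$ is the set of vertices of minimum eccentricity; it consists of either one vertex $w$ or two adjacent vertices $w,w'$ (the central vertex/vertices). $T$ is viewed as rooted at its central vertex, or at both central vertices (both at level $0$). A vertex $v$ is a descendent of $u$ if $u$ lies on the path joining $v$ to the (nearest) central vertex. For $u\notin C(T)$ adjacent to a central vertex, the subtree induced by $u$ and all its descendents is called the branch at $u$. Two branches are different if they are at two (distinct) vertices adjacent to the same central vertex, and opposite if they are at two vertices adjacent to different central vertices. $N(w)$ is the set of neighbours of $w$, and $\Delta(T)$ is the maximum degree. For $u\in V(T)$ put $\mathcal{L}(u)=\min\{D(u,w): w\in C(T)\}$ and $\mathcal{L}(T)=\sum_{u\in V(T)}\mathcal{L}(u)$. Put $\varepsilon(T)=0$ if $|C(T)|=1$, $\varepsilon(T)=1$ if $|C(T)|=2$, and $\varepsilon'(T)=1-\varepsilon(T)$. -}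

module Defs where

open import Data.Fin.Base using (Fin; zero; suc)
open import Data.Fin.Properties using (_≟_; all?; injective⇒≤)
open import Data.List.Base using (List; []; _∷_; length; map; filter; concatMap; upTo; allFin; lookup)
open import Data.List.Extrema.Nat using (max; min; argmin-sel; argmax-sel; xs≤max; min≤xs)
open import Data.List.Membership.Propositional using (_∈_; lose)
open import Data.List.Membership.Propositional.Properties using (∈-map⁺; ∈-map⁻; ∈-filter⁺; ∈-filter⁻; ∈-concatMap⁺; ∈-upTo⁺; ∈-allFin; ∈-lookup)
open import Data.List.Relation.Unary.All as All using ()
open import Data.List.Relation.Unary.Any using (here)
open import Data.List.Relation.Unary.Unique.Propositional using (Unique; _∷_)
import Data.List.Relation.Unary.Unique.DecPropositional as UniqueDec
open import Data.Nat.Base using (ℕ; zero; suc; _+_; _∸_; _≤_; _<_; ∣_-_∣)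
open import Data.Nat.Properties using (_≤?_; n≤0⇒n≡0; <⇒≱)
open import Data.Nat.ListAction using (sum)
open import Data.Product.Base using (Σ-syntax; ∃-syntax; _×_; _,_; proj₁; proj₂)
open import Data.Sum.Base using (_⊎_; inj₁; inj₂)
open import Function.Definitions using (Injective)
open import Level using (0ℓ)
open import Relation.Binary.Core using (Rel)
open import Relation.Binary.Definitions using (Decidable; Symmetric; Irreflexive)
open import Relation.Binary.PropositionalEquality using (_≡_; _≢_; refl; sym; trans; cong; subst)
open import Relation.Nullary using (Dec; yes; no; ¬_; contradiction)
import Relation.Unary as U

record Graph (n : ℕ) : Set₁ where
  infix 4 _∼_ _∼?_
  field
    _∼_      : Rel (Fin n) 0ℓ
    _∼?_     : Decidable _∼_
    ∼-sym    : Symmetric _∼_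
    ∼-irrefl : Irreflexive _≡_ _∼_

module _ {n : ℕ} (G : Graph n) where
  open Graph G

  infixr 5 _∷_

  data Walk : Fin n → Fin n → Set where
    []  : ∀ {u} → Walk u u
    _∷_ : ∀ {u v w} → u ∼ v → Walk v w → Walk u w

  N : Fin n → U.Pred (Fin n) 0ℓ
  N v = v ∼_

  degree : Fin n → ℕ
  degree v = length (filter (v ∼?_) (allFin n))

  Δ : ℕ
  Δ = max 0 (map degree (allFin n))

module _ {n : ℕ} {G : Graph n} where

  vertices : ∀ {u v} → Walk G u v → List (Fin n)
  vertices {u} []      = u ∷ []
  vertices {u} (_ ∷ p) = u ∷ vertices p

  len : ∀ {u v} → Walk G u v → ℕ
  len []      = 0
  len (_ ∷ p) = suc (len p)

  IsPath : ∀ {u v} → Walk G u v → Set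
  IsPath p = Unique (vertices p)

  isPath? : ∀ {u v} → U.Decidable (IsPath {u} {v})
  isPath? p = UniqueDec.unique? _≟_ (vertices p)

module _ {n : ℕ} (G : Graph n) where
  open Graph G

  Connected : Set
  Connected = ∀ u v → Σ[ p ∈ Walk G u v ] IsPath p

  -- A cycle is a path with at least three vertices whose ends are adjacent.
  Acyclic : Set
  Acyclic = ∀ {u v} (p : Walk G u v) → IsPath p → 2 ≤ len p → ¬ (v ∼ u)

  IsTree : Set
  IsTree = Connected × Acyclic

  prepend : ∀ {u x v} → Dec (u ∼ x) → List (Walk G x v) → List (Walk G u v)
  prepend (yes e) ps = map (e ∷_) ps
  prepend (no  _) ps = []

  -- A path has fewer than n edges, so listing the walks of length below n
  -- reaches the vertex sequence of every path (see len∈).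
  walks : ℕ → ∀ u v → List (Walk G u v)
  walks zero u v with u ≟ v
  ... | yes refl = [] ∷ []
  ... | no  _    = []
  walks (suc k) u v = concatMap (λ x → prepend (u ∼? x) (walks k x v)) (allFin n)

  paths : ∀ u v → List (Walk G u v)
  paths u v = filter isPath? (concatMap (λ k → walks k u v) (upTo n))

  -- Detour distance; D-attained and D-greatest below characterise it.
  D : Fin n → Fin n → ℕ
  D u v = max 0 (map len (paths u v))

  -- Ordinary distance; n is not attained in a connected graph.
  d : Fin n → Fin n → ℕ
  d u v = min n (map len (paths u v))

  private
    ∈-prepend : ∀ {u x v} (e? : Dec (u ∼ x)) → u ∼ x → {q : Walk G x v} {ps : List (Walk G x v)} →
      q ∈ ps → Σ[ e ∈ u ∼ x ] (e ∷ q) ∈ prepend e? ps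
    ∈-prepend (yes e) _ q∈ = e , ∈-map⁺ (e ∷_) q∈
    ∈-prepend (no ¬e) e _  = contradiction e ¬e

    walks-complete : ∀ {u v} (p : Walk G u v) →
      Σ[ q ∈ Walk G u v ] q ∈ walks (len p) u v × vertices q ≡ vertices p × len q ≡ len p
    walks-complete {u} [] with u ≟ u
    ... | yes refl = [] , here refl , refl , refl
    ... | no  u≢u  = contradiction refl u≢u
    walks-complete {u} {v} (_∷_ {v = x} e p) with walks-complete p
    ... | q , q∈ , vs≡ , l≡ with ∈-prepend (u ∼? x) e q∈
    ...   | e′ , q∈′ =
      e′ ∷ q , ∈-concatMap⁺ _ (lose (∈-allFin x) q∈′) , cong (u ∷_) vs≡ , cong suc l≡

    lookup-injective : ∀ {xs : List (Fin n)} → Unique xs → Injective _≡_ _≡_ (lookup xs)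
    lookup-injective (_  ∷ _)  {zero}  {zero}  _  = refl
    lookup-injective (px ∷ _)  {zero}  {suc j} eq = contradiction eq (All.lookup px (∈-lookup j))
    lookup-injective (px ∷ _)  {suc i} {zero}  eq = contradiction (sym eq) (All.lookup px (∈-lookup i))
    lookup-injective (_  ∷ ps) {suc i} {suc j} eq = cong suc (lookup-injective ps eq)

    length-vertices : ∀ {u v} (p : Walk G u v) → length (vertices p) ≡ suc (len p)
    length-vertices []      = refl
    length-vertices (_ ∷ p) = cong suc (length-vertices p)

  len<n : ∀ {u v} (p : Walk G u v) → IsPath p → len p < n
  len<n p pp = subst (_≤ n) (length-vertices p) (injective⇒≤ (lookup-injective pp))

  len∈ : ∀ {u v} (p : Walk G u v) → IsPath p → len p ∈ map len (paths u v)
  len∈ {u} {v} p pp with walks-complete p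
  ... | q , q∈ , vs≡ , l≡ =
    subst (_∈ map len (paths u v)) l≡
      (∈-map⁺ len
        (∈-filter⁺ isPath? (∈-concatMap⁺ _ (lose (∈-upTo⁺ (len<n p pp)) q∈))
          (subst Unique (sym vs≡) pp)))

  private
    ∈len : ∀ {u v k} → k ∈ map len (paths u v) → Σ[ p ∈ Walk G u v ] IsPath p × len p ≡ k
    ∈len k∈ with ∈-map⁻ len k∈
    ... | p , p∈ , k≡ =
      p , proj₂ (∈-filter⁻ isPath? {xs = concatMap (λ k → walks k _ _) (upTo n)} p∈) , sym k≡

  D-greatest : ∀ {u v} (p : Walk G u v) → IsPath p → len p ≤ D u v
  D-greatest p pp = All.lookup (xs≤max 0 _) (len∈ p pp)

  d-least : ∀ {u v} (p : Walk G u v) → IsPath p → d u v ≤ len p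
  d-least p pp = All.lookup (min≤xs n _) (len∈ p pp)

  D-attained : Connected → ∀ u v → Σ[ p ∈ Walk G u v ] IsPath p × len p ≡ D u v
  D-attained conn u v with argmax-sel (λ k → k) 0 (map len (paths u v))
  ... | inj₂ D∈ = ∈len D∈
  ... | inj₁ D≡0 with conn u v
  ...   | p , pp = p , pp , trans (n≤0⇒n≡0 (subst (len p ≤_) D≡0 (D-greatest p pp))) (sym D≡0)

  d-attained : Connected → ∀ u v → Σ[ p ∈ Walk G u v ] IsPath p × len p ≡ d u v
  d-attained conn u v with argmin-sel (λ k → k) n (map len (paths u v))
  ... | inj₂ d∈ = ∈len d∈
  ... | inj₁ d≡n with conn u v
  ...   | p , pp = contradiction (subst (_≤ len p) d≡n (d-least p pp)) (<⇒≱ (len<n p pp))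

  ecc : Fin n → ℕ
  ecc v = max 0 (map (d v) (allFin n))

  Central : U.Pred (Fin n) 0ℓ
  Central v = ∀ x → ecc v ≤ ecc x

  central? : U.Decidable Central
  central? v = all? (λ x → ecc v ≤? ecc x)

  centre : List (Fin n)
  centre = filter central? (allFin n)

  -- Every D u w is below n, so the default n never wins for a non-empty centre.
  𝓛 : Fin n → ℕ
  𝓛 u = min n (map (D u) centre)

  𝓛-total : ℕ
  𝓛-total = sum (map 𝓛 (allFin n))

  -- 0 or 1 according as the centre has one or two vertices, the only cases in a tree.
  ε : ℕ
  ε = length centre ∸ 1

  ε′ : ℕ
  ε′ = 1 ∸ ε

  NearestCentral : Fin n → Fin n → Set
  NearestCentral v w = Central w × D v w ≡ 𝓛 v

  -- Descendent v u: v is a descendent of u; in particular u is one of itself.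
  Descendent : Fin n → Fin n → Set
  Descendent v u =
    ∃[ w ] NearestCentral v w × Σ[ p ∈ Walk G v w ] IsPath p × u ∈ vertices p

  BranchAt : Fin n → Fin n → Set
  BranchAt b w = ¬ Central b × Central w × w ∼ b

  DifferentBranches : Fin n → Fin n → Set
  DifferentBranches x y =
    ∃[ w ] ∃[ b ] ∃[ b′ ]
      BranchAt b w × BranchAt b′ w × b ≢ b′ × Descendent x b × Descendent y b′

  -- A central vertex belongs to no branch but lies on its own side.
  OnSideOf : Fin n → Fin n → Set
  OnSideOf x w = Central w × (x ≡ w ⊎ ∃[ b ] BranchAt b w × Descendent x b)

  OppositeBranches : Fin n → Fin n → Set
  OppositeBranches x y = ∃[ w ] ∃[ w′ ] w ≢ w′ × OnSideOf x w × OnSideOf y w′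

  IsHamiltonianColoring : (Fin n → ℕ) → Set
  IsHamiltonianColoring c = ∀ u v → u ≢ v → n ∸ 1 ≤ D u v + ∣ c u - c v ∣

-- Usually written hc(c).
maxColor : ∀ {n} → (Fin n → ℕ) → ℕ
maxColor {n} c = max 0 (map c (allFin n))

-- HasHC G h: the minimum of maxColor over all hamiltonian colourings of G
-- exists and equals h, i.e. hc(G) = h.
HasHC : ∀ {n} → Graph n → ℕ → Set
HasHC G h =
  (∃[ c ] IsHamiltonianColoring G c × maxColor c ≡ h) ×
  (∀ c → IsHamiltonianColoring G c → h ≤ maxColor c)

{-# OPTIONS --safe #-}

-- List the vertices by increasing colour. Consecutive colours differ by at least
-- n − 1 − D(x, y), and D(x, y) ≤ 𝓛(x) + 𝓛(y) + ε since a detour through the centre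
-- costs that much; summing over the list gives the lower bound, the two ends
-- contributing at least ε′. For the given order every one of these inequalities is
-- an equality. Its colouring is hamiltonian because D ≤ n/2 for consecutive vertices
-- makes two successive gaps add up to at least n − 2, so only consecutive vertices
-- need their exact distance. That the centre is one vertex or one edge follows from
-- acyclicity.

module Submission where

open import Defs
open import Algebra.Definitions using (Congruent₂)
open import Data.Empty using (⊥; ⊥-elim)
open import Data.Fin.Base using (Fin; zero; suc; toℕ; fromℕ<)
open import Data.Fin.Properties using (_≟_; toℕ-injective; toℕ<n; toℕ-fromℕ<)
open import Data.Integer.Base as ℤ using (+_)
open import Data.Integer.Properties using (+-injective; pos-*)
import Data.Integer.Tactic.RingSolver as ℤ-Solver
open import Data.List.Base using (List; []; _∷_; length; map; allFin; tabulate)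
open import Data.List.Extrema.Nat using (argmin; f[argmin]≤f[xs]; argmin-sel; xs≤max; min≤xs; max<v⁺; max≤v⁺)
open import Data.List.Membership.Propositional using (_∈_)
open import Data.List.Membership.Propositional.Properties using (∈-map⁺; ∈-map⁻; ∈-filter⁺; ∈-filter⁻; ∈-allFin; ∈-tabulate⁺)
open import Data.List.Membership.Propositional.Properties.WithK using (unique∧set⇒bag)
open import Data.List.Properties using (length-tabulate)
open import Data.List.Relation.Binary.BagAndSetEquality using (∼bag⇒↭)
open import Data.List.Relation.Binary.Permutation.Propositional using (_↭_; ↭-sym; ↭⇒↭ₛ)
open import Data.List.Relation.Binary.Permutation.Propositional.Properties using (↭-length; map⁺)
open import Data.List.Relation.Binary.Permutation.Setoid.Properties using (Unique-resp-↭)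
open import Data.List.Relation.Binary.Subset.Propositional using (_⊆_)
open import Data.List.Relation.Unary.All as All using ([]; _∷_)
import Data.List.Relation.Unary.All.Properties as All
open import Data.List.Relation.Unary.AllPairs using ([]; _∷_)
open import Data.List.Relation.Unary.Any using (here; there)
open import Data.List.Relation.Unary.Linked as Linked using (Linked; []; [-]; _∷_)
open import Data.List.Relation.Unary.Linked.Properties using (AllPairs⇒Linked)
open import Data.List.Relation.Unary.Unique.Propositional using (Unique)
import Data.List.Relation.Unary.Unique.Propositional.Properties as Unique
import Data.List.Sort as Sort
open import Data.Nat.Base using (ℕ; zero; suc; _+_; _∸_; _*_; _≤_; _<_; z≤n; s≤s; s≤s⁻¹; ∣_-_∣)
open import Data.Nat.ListAction using (sum)
open import Data.Nat.ListAction.Properties using (sum-↭)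
open import Data.Nat.Properties hiding (_≟_)
open import Data.Nat.Tactic.RingSolver using (solve-∀)
open import Data.Product.Base using (Σ-syntax; ∃-syntax; _×_; _,_; proj₁; proj₂)
open import Data.Sum.Base using (_⊎_; inj₁; inj₂; swap)
open import Function.Bundles using (mk⇔)
open import Function.Definitions using (Bijective)
open import Relation.Binary.Construct.On as On using ()
open import Relation.Binary.Definitions using (tri<; tri≈; tri>)
open import Relation.Binary.PropositionalEquality using (_≡_; _≢_; refl; ≢-sym; sym; trans; cong; cong₂; subst; subst₂; setoid; module ≡-Reasoning)
open import Relation.Binary.PropositionalEquality.Properties using () renaming (isPreorder to ≡-isPreorder)
open import Relation.Binary.Structures using (IsPreorder)
open import Relation.Nullary using (¬_; Dec; yes; no; contradiction)
open import Relation.Unary using (_≐_; _∪_; ｛_｝)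

+-swapʳ : ∀ a b d → a + b + d ≡ a + d + b
+-swapʳ = solve-∀

-- Walks and their joins in an arbitrary graph.

module _ {n : ℕ} {G : Graph n} where
  open Graph G

  -- Two paths from a common vertex are compared by their second vertices; the empty walk has none.
  Starts : Fin n → ∀ {u v} → Walk G u v → Set
  Starts x []                = ⊥
  Starts x (_∷_ {v = y} _ _) = x ≡ y

  starts? : ∀ x {u v} (p : Walk G u v) → Dec (Starts x p)
  starts? x []                = no λ ()
  starts? x (_∷_ {v = y} _ _) = x ≟ y

  starts-injective : ∀ {a b u v} (q : Walk G u v) → Starts a q → Starts b q → a ≡ b
  starts-injective (_ ∷ _) refl refl = refl

  end∈ : ∀ {u v} (p : Walk G u v) → v ∈ vertices p
  end∈ []      = here refl
  end∈ (_ ∷ p) = there (end∈ p)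

  start∈ : ∀ {u v} (p : Walk G u v) → u ∈ vertices p
  start∈ []      = here refl
  start∈ (_ ∷ _) = here refl

  starts-∈ : ∀ {x u v} (p : Walk G u v) → Starts x p → x ∈ vertices p
  starts-∈ (_ ∷ p) refl = there (start∈ p)

  prefix : ∀ {u v x} (p : Walk G u v) → x ∈ vertices p → Walk G u x
  prefix []      (here refl) = []
  prefix (_ ∷ _) (here refl) = []
  prefix (e ∷ p) (there x∈)  = e ∷ prefix p x∈

  prefix-⊆ : ∀ {u v x} (p : Walk G u v) (x∈ : x ∈ vertices p) → vertices (prefix p x∈) ⊆ vertices p
  prefix-⊆ []      (here refl) y∈          = y∈
  prefix-⊆ (_ ∷ _) (here refl) (here refl) = here refl
  prefix-⊆ (_ ∷ _) (there x∈)  (here refl) = here refl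
  prefix-⊆ (_ ∷ p) (there x∈)  (there y∈)  = there (prefix-⊆ p x∈ y∈)

  prefix-path : ∀ {u v x} (p : Walk G u v) (x∈ : x ∈ vertices p) → IsPath p → IsPath (prefix p x∈)
  prefix-path []      (here refl) pp        = pp
  prefix-path (_ ∷ _) (here refl) pp        = [] ∷ []
  prefix-path (_ ∷ p) (there x∈)  (px ∷ pp) =
    All.tabulate (λ y∈ → All.lookup px (prefix-⊆ p x∈ y∈)) ∷ prefix-path p x∈ pp

  loop-empty : ∀ {u} (p : Walk G u u) → IsPath p → len p ≡ 0
  loop-empty []      _        = refl
  loop-empty (_ ∷ p) (px ∷ _) = contradiction refl (All.lookup px (end∈ p))

  ≢⇒1≤len : ∀ {u v} → u ≢ v → (p : Walk G u v) → 1 ≤ len p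
  ≢⇒1≤len u≢v []      = contradiction refl u≢v
  ≢⇒1≤len u≢v (_ ∷ _) = s≤s z≤n

  -- p ⟲ q runs back along p and then along q.
  infixl 4 _⟲_

  _⟲_ : ∀ {u v w} → Walk G u v → Walk G u w → Walk G v w
  []      ⟲ q = q
  (e ∷ p) ⟲ q = p ⟲ (∼-sym e ∷ q)

  len-⟲ : ∀ {u v w} (p : Walk G u v) (q : Walk G u w) → len (p ⟲ q) ≡ len p + len q
  len-⟲ []      q = refl
  len-⟲ (e ∷ p) q = trans (len-⟲ p (∼-sym e ∷ q)) (+-suc (len p) (len q))

  ∈-⟲⁺ʳ : ∀ {u v w} (p : Walk G u v) (q : Walk G u w) → vertices q ⊆ vertices (p ⟲ q)
  ∈-⟲⁺ʳ []      q x∈ = x∈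
  ∈-⟲⁺ʳ (e ∷ p) q x∈ = ∈-⟲⁺ʳ p (∼-sym e ∷ q) (there x∈)

  ∈-⟲⁺ˡ : ∀ {u v w} (p : Walk G u v) (q : Walk G u w) → vertices p ⊆ vertices (p ⟲ q)
  ∈-⟲⁺ˡ []      q (here refl) = start∈ q
  ∈-⟲⁺ˡ (e ∷ p) q (here refl) = ∈-⟲⁺ʳ p (∼-sym e ∷ q) (there (start∈ q))
  ∈-⟲⁺ˡ (e ∷ p) q (there x∈)  = ∈-⟲⁺ˡ p (∼-sym e ∷ q) x∈

-- Unique paths and distances in a tree.

module Tree {n : ℕ} (T : Graph n) (tree : IsTree T) where
  open Graph T

  connected : Connected T
  connected = proj₁ tree

  acyclic : Acyclic T
  acyclic = proj₂ tree

  -- Otherwise the part of `p` up to `x` has length at least two, and the edge from `x` to `u`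
  -- closes it to a cycle.
  neighbour-starts : ∀ {x u v} (p : Walk T u v) → IsPath p → x ∈ vertices p → x ∼ u → Starts x p
  neighbour-starts []      _ (here refl) x∼u = ∼-irrefl refl x∼u
  neighbour-starts (_ ∷ _) _ (here refl) x∼u = ⊥-elim (∼-irrefl refl x∼u)
  neighbour-starts {x} (_∷_ {v = y} e p) pp (there x∈) x∼u with x ≟ y
  ... | yes x≡y = x≡y
  ... | no  x≢y = contradiction x∼u
    (acyclic (e ∷ prefix p x∈) (prefix-path (e ∷ p) (there x∈) pp)
      (s≤s (≢⇒1≤len (λ y≡x → x≢y (sym y≡x)) (prefix p x∈))))

  -- If `x` already lay on `p`, it would be a neighbour of `u` on `p`, hence its second vertex.
  extend : ∀ {x u v} (e : x ∼ u) (p : Walk T u v) → IsPath p → ¬ Starts x p → IsPath (e ∷ p)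
  extend e p pp ¬s =
    All.tabulate (λ y∈ x≡y → ¬s (neighbour-starts p pp (subst (_∈ vertices p) (sym x≡y) y∈) e)) ∷ pp

  -- Moving the first edge of `p` over to the second path preserves the hypothesis: that path now
  -- begins by returning to the old common vertex, which the rest of `p` avoids.
  ⟲-path : ∀ {u v w} (p : Walk T u v) (q : Walk T u w) → IsPath p → IsPath q →
    (∀ {x} → Starts x p → ¬ Starts x q) → IsPath (p ⟲ q)
  ⟲-path []      q _  qq _  = qq
  ⟲-path (e ∷ p) q (px ∷ pp) qq ¬s =
    ⟲-path p (∼-sym e ∷ q) pp (extend (∼-sym e) q qq (¬s refl))
      (λ { s refl → All.lookup px (starts-∈ p s) refl })

  reverse-path : ∀ {u v} (p : Walk T u v) → IsPath p → IsPath (p ⟲ [])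
  reverse-path p pp = ⟲-path p [] pp ([] ∷ []) (λ _ ())

  len-reverse : ∀ {u v} (p : Walk T u v) → len (p ⟲ []) ≡ len p
  len-reverse p = trans (len-⟲ p []) (+-identityʳ (len p))

  -- If the first steps differed, joining the two paths at their start would give a closed path of
  -- positive length. The walks may still differ in their proofs of adjacency, so lengths and vertex
  -- lists are compared.
  path-unique : ∀ {u v} (p q : Walk T u v) → IsPath p → IsPath q →
    len p ≡ len q × vertices p ≡ vertices q
  path-unique []      []      _ _ = refl , refl
  path-unique []      (f ∷ q) _ qq = contradiction (sym (loop-empty (f ∷ q) qq)) λ ()
  path-unique (e ∷ p) []      pp _ = contradiction (loop-empty (e ∷ p) pp) λ ()
  path-unique {u} (_∷_ {v = x} e p) (_∷_ {v = y} f q) (px ∷ pp) (qx ∷ qq) with x ≟ y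
  ... | yes refl with path-unique p q pp qq
  ...   | l , vs = cong suc l , cong (u ∷_) vs
  path-unique (_∷_ {v = x} e p) (_∷_ {v = y} f q) pp qq | no x≢y =
    contradiction
      (trans (sym (len-⟲ (e ∷ p) (f ∷ q)))
        (loop-empty _ (⟲-path (e ∷ p) (f ∷ q) pp qq (λ { refl x≡y → x≢y x≡y }))))
      λ ()

  D≡len : ∀ {u v} (p : Walk T u v) → IsPath p → D T u v ≡ len p
  D≡len {u} {v} p pp with D-attained T connected u v
  ... | q , qq , l = trans (sym l) (proj₁ (path-unique q p qq pp))

  d≡len : ∀ {u v} (p : Walk T u v) → IsPath p → d T u v ≡ len p
  d≡len {u} {v} p pp with d-attained T connected u v
  ... | q , qq , l = trans (sym l) (proj₁ (path-unique q p qq pp))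

  D-refl : ∀ u → D T u u ≡ 0
  D-refl u = D≡len [] ([] ∷ [])

  D-sym : ∀ u v → D T u v ≡ D T v u
  D-sym u v with connected u v
  ... | p , pp = trans (D≡len p pp)
    (sym (trans (D≡len _ (reverse-path p pp)) (len-reverse p)))

  ≢⇒1≤D : ∀ {u v} → u ≢ v → 1 ≤ D T u v
  ≢⇒1≤D {u} {v} u≢v with D-attained T connected u v
  ... | p , _ , l = subst (1 ≤_) l (≢⇒1≤len u≢v p)

  D-adjacent : ∀ {u v} → u ∼ v → D T u v ≡ 1
  D-adjacent e = D≡len (e ∷ []) (extend e [] ([] ∷ []) λ ())

  fork : ∀ {w x y} (p : Walk T w x) (q : Walk T w y) → IsPath p → IsPath q →
    D T x y ≤ len p + len q
  fork [] q _ qq = ≤-reflexive (D≡len q qq)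
  fork p@(_ ∷ _) [] pp _ =
    ≤-reflexive (trans (D≡len _ (reverse-path p pp)) (len-⟲ p []))
  fork (_∷_ {v = a} e p) (_∷_ {v = b} f q) pp qq with a ≟ b
  fork (e ∷ p) (f ∷ q) (_ ∷ pp) (_ ∷ qq) | yes refl =
    ≤-trans (fork p q pp qq) (+-mono-≤ (n≤1+n (len p)) (n≤1+n (len q)))
  ... | no a≢b = ≤-reflexive (trans
    (D≡len _ (⟲-path (e ∷ p) (f ∷ q) pp qq (λ { refl a≡b → a≢b a≡b })))
    (len-⟲ (e ∷ p) (f ∷ q)))

  D-triangle : ∀ x w y → D T x y ≤ D T x w + D T w y
  D-triangle x w y with connected w x | connected w y
  ... | p , pp | q , qq = subst (D T x y ≤_)
    (cong₂ _+_ (trans (sym (D≡len p pp)) (D-sym w x)) (sym (D≡len q qq))) (fork p q pp qq)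

  -- Eccentricity and the shape of the centre.

  len≤ecc : ∀ {u v} (p : Walk T u v) → IsPath p → len p ≤ ecc T u
  len≤ecc {u} {v} p pp = subst (_≤ ecc T u) (d≡len p pp)
    (All.lookup (xs≤max 0 _) (∈-map⁺ (d T u) (∈-allFin v)))

  -- A vertex strictly inside the path from w to w′ is nearer than w or w′ to
  -- every vertex v, since the path to v leaves towards at most one of them.
  central-adjacent : ∀ {w w′} → Central T w → Central T w′ → w ≢ w′ → w ∼ w′
  central-adjacent {w} {w′} cw cw′ w≢w′ with connected w w′
  ... | [] , _ = contradiction refl w≢w′
  ... | e ∷ [] , _ = e
  ... | _∷_ {v = x} e (_∷_ {v = y} f p) , (w∉ ∷ pp) = contradiction (cw x) (<⇒≱ ecc<)
    where
    leave : ∀ v → d T x v < ecc T w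
    leave v with connected x v
    ... | r , rr with starts? w r
    ...   | no ¬s = subst (_< ecc T w) (sym (d≡len r rr)) (len≤ecc (e ∷ r) (extend e r rr ¬s))
    ...   | yes s = begin-strict
      d T x v              ≡⟨ d≡len r rr ⟩
      len r                <⟨ m<n+m (len r) (s≤s z≤n) ⟩
      suc (len p) + len r  ≡⟨ len-⟲ (f ∷ p) r ⟨
      len (f ∷ p ⟲ r)      ≤⟨ len≤ecc (f ∷ p ⟲ r) (⟲-path (f ∷ p) r pp rr diverge) ⟩
      ecc T w′             ≤⟨ cw′ w ⟩
      ecc T w              ∎
      where
      open ≤-Reasoning
      diverge : ∀ {z} → Starts z (f ∷ p) → ¬ Starts z r
      diverge refl s′ = All.lookup w∉ (there (start∈ p)) (starts-injective r s s′)
    ecc< : ecc T x < ecc T w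
    -- The first argument deals with the default value 0 of `max`: a distance strictly below
    -- `ecc T w` makes that number positive.
    ecc< = max<v⁺ {xs = map (d T x) (allFin n)} (≤-<-trans z≤n (leave w)) (All.map⁺ (All.tabulate λ {v} _ → leave v))

  ∈-centre⁺ : ∀ {w} → Central T w → w ∈ centre T
  ∈-centre⁺ {w} = ∈-filter⁺ (central? T) (∈-allFin w)

  ∈-centre⁻ : ∀ {w} → w ∈ centre T → Central T w
  ∈-centre⁻ w∈ = proj₂ (∈-filter⁻ (central? T) {xs = allFin n} w∈)

  central-exists : Fin n → ∃[ w ] Central T w
  central-exists v = argmin (ecc T) v (allFin n) ,
    λ x → All.lookup (f[argmin]≤f[xs] v (allFin n)) (∈-allFin x)

  data Centre : Set where
    one : ∀ w → Central T ≐ ｛ w ｝ → ε T ≡ 0 → Centre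
    two : ∀ w w′ → w ≢ w′ → w ∼ w′ → Central T ≐ ｛ w ｝ ∪ ｛ w′ ｝ → ε T ≡ 1 → Centre

  -- The vertex argument guarantees a nonempty centre. A third central vertex is impossible: central
  -- vertices are pairwise adjacent, so three would form a triangle.
  classify : Fin n → Centre
  classify v = go (centre T) refl
    where
    go : ∀ xs → centre T ≡ xs → Centre
    go [] eq = let w , cw = central-exists v in
      contradiction (subst (w ∈_) eq (∈-centre⁺ {w} cw)) λ ()
    go (w ∷ []) eq = one w
      ((λ c → single (subst (_ ∈_) eq (∈-centre⁺ c))) ,
       (λ { refl → ∈-centre⁻ (subst (w ∈_) (sym eq) (here refl)) }))
      (cong (λ xs → length xs ∸ 1) eq)
      where
      single : ∀ {x} → x ∈ w ∷ [] → w ≡ x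
      single (here refl) = refl
    go (w ∷ w′ ∷ xs) eq with subst Unique eq (Unique.filter⁺ (central? T) (Unique.allFin⁺ n))
    ... | (w≢w′ ∷ w∉) ∷ (w′∉ ∷ _) = go′ xs refl
      where
      cw : Central T w
      cw = ∈-centre⁻ (subst (w ∈_) (sym eq) (here refl))
      cw′ : Central T w′
      cw′ = ∈-centre⁻ (subst (w′ ∈_) (sym eq) (there (here refl)))
      w∼w′ : w ∼ w′
      w∼w′ = central-adjacent cw cw′ w≢w′
      go′ : ∀ ys → xs ≡ ys → Centre
      go′ [] refl = two w w′ w≢w′ w∼w′
        ((λ c → pair (subst (_ ∈_) eq (∈-centre⁺ c))) ,
         (λ { (inj₁ refl) → cw ; (inj₂ refl) → cw′ }))
        (cong (λ xs → length xs ∸ 1) eq)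
        where
        pair : ∀ {x} → x ∈ w ∷ w′ ∷ [] → w ≡ x ⊎ w′ ≡ x
        pair (here refl)         = inj₁ refl
        pair (there (here refl)) = inj₂ refl
      go′ (w″ ∷ _) refl = contradiction (central-adjacent cw″ cw (λ w″≡w → w≢w″ (sym w″≡w)))
        (acyclic (w∼w′ ∷ w′∼w″ ∷ [])
          ((w≢w′ ∷ w≢w″ ∷ []) ∷ (w′≢w″ ∷ []) ∷ [] ∷ []) (s≤s (s≤s z≤n)))
        where
        cw″ : Central T w″
        cw″ = ∈-centre⁻ (subst (w″ ∈_) (sym eq) (there (there (here refl))))
        w≢w″ : w ≢ w″
        w≢w″ = All.head w∉
        w′≢w″ : w′ ≢ w″
        w′≢w″ = All.head w′∉
        w′∼w″ : w′ ∼ w″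
        w′∼w″ = central-adjacent cw′ cw″ w′≢w″

  D-central≤ε : ∀ {w w′} → Central T w → Central T w′ → D T w w′ ≤ ε T
  D-central≤ε {w} {w′} cw cw′ = go (w ≟ w′)
    where
    1≤ε : w ≢ w′ → Centre → 1 ≤ ε T
    1≤ε w≢w′ (one z C≐ _)        = contradiction (trans (sym (proj₁ C≐ cw)) (proj₁ C≐ cw′)) w≢w′
    1≤ε _    (two _ _ _ _ _ ε≡1) = ≤-reflexive (sym ε≡1)
    go : Dec (w ≡ w′) → D T w w′ ≤ ε T
    go (yes refl) = ≤-trans (≤-reflexive (D-refl w)) z≤n
    go (no  w≢w′) = ≤-trans (≤-reflexive (D-adjacent (central-adjacent cw cw′ w≢w′))) (1≤ε w≢w′ (classify w))

  -- Levels and the upper bound on distances.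

  𝓛≤D : ∀ {w} → Central T w → ∀ u → 𝓛 T u ≤ D T u w
  𝓛≤D cw u = All.lookup (min≤xs n _) (∈-map⁺ (D T u) (∈-centre⁺ cw))

  𝓛-attained : ∀ u → ∃[ w ] NearestCentral T u w
  𝓛-attained u = go (argmin-sel (λ k → k) n (map (D T u) (centre T)))
    where
    go : 𝓛 T u ≡ n ⊎ 𝓛 T u ∈ map (D T u) (centre T) → ∃[ w ] NearestCentral T u w
    go (inj₂ 𝓛∈)  = let w , w∈ , eq = ∈-map⁻ (D T u) 𝓛∈ in w , ∈-centre⁻ w∈ , sym eq
    -- The default value `n` of `min` cannot win: a path to a central vertex has fewer than `n`
    -- edges.
    go (inj₁ 𝓛≡n) =
      let w , cw     = central-exists u
          p , pp , l = D-attained T connected u w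
      in contradiction (≤-trans (≤-reflexive (sym 𝓛≡n)) (𝓛≤D cw u))
           (<⇒≱ (≤-trans (s≤s (≤-reflexive (sym l))) (len<n T p pp)))

  𝓛-central : ∀ {w} → Central T w → 𝓛 T w ≡ 0
  𝓛-central {w} cw = n≤0⇒n≡0 (subst (𝓛 T w ≤_) (D-refl w) (𝓛≤D cw w))

  𝓛≡0⇒central : ∀ {u} → 𝓛 T u ≡ 0 → Central T u
  𝓛≡0⇒central {u} 𝓛≡0 = go (𝓛-attained u)
    where
    go : ∃[ w ] NearestCentral T u w → Central T u
    go (w , cw , D≡) = from (u ≟ w)
      where
      from : Dec (u ≡ w) → Central T u
      from (yes refl) = cw
      from (no  u≢w)  = contradiction (trans D≡ 𝓛≡0) (≢-sym (<⇒≢ (≢⇒1≤D u≢w)))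

  -- Route through the central vertex nearest to `x` and then the one nearest to `y`; these are at
  -- most `ε T` apart.
  D≤𝓛+𝓛+ε : ∀ x y → D T x y ≤ 𝓛 T x + 𝓛 T y + ε T
  D≤𝓛+𝓛+ε x y =
    let w  , cw  , Dx = 𝓛-attained x
        w′ , cw′ , Dy = 𝓛-attained y
    in detour (D T x y) (D T x w) (D T w y) (D T w w′) (D T w′ y) (𝓛 T x) (𝓛 T y) (ε T)
      (D-triangle x w y) (D-triangle w w′ y) (D-central≤ε cw cw′) Dx (trans (D-sym w′ y) Dy)
    where
    detour : ∀ xy xw wy ww′ w′y lx ly e → xy ≤ xw + wy → wy ≤ ww′ + w′y → ww′ ≤ e →
      xw ≡ lx → w′y ≡ ly → xy ≤ lx + ly + e
    detour xy xw wy ww′ w′y _ _ e xy≤ wy≤ ww′≤ refl refl = begin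
      xy                ≤⟨ xy≤ ⟩
      xw + wy           ≤⟨ +-monoʳ-≤ xw wy≤ ⟩
      xw + (ww′ + w′y)  ≤⟨ +-monoʳ-≤ xw (+-monoˡ-≤ w′y ww′≤) ⟩
      xw + (e + w′y)    ≡⟨ regroup xw e w′y ⟩
      xw + w′y + e      ∎
      where
      open ≤-Reasoning
      regroup : ∀ a b d → a + (b + d) ≡ a + d + b
      regroup = solve-∀

  -- Branches, sides and the matching lower bound on distances.

  -- `Descendent` speaks of paths towards the centre, while divergence is judged on paths leaving
  -- it; uniqueness of paths links the two.
  on-path : ∀ {x w u} (p : Walk T x w) → IsPath p → u ∈ vertices p →
    (q : Walk T w x) → IsPath q → u ∈ vertices q
  on-path p pp u∈ q qq = subst (_ ∈_) (proj₂ (path-unique (p ⟲ []) q (reverse-path p pp) qq)) (∈-⟲⁺ˡ p [] u∈)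

  ⟲≤D : ∀ {w x y} (p : Walk T w x) (q : Walk T w y) → IsPath p → IsPath q →
    (∀ {z} → Starts z p → ¬ Starts z q) → len p + len q ≤ D T x y
  ⟲≤D p q pp qq ¬s = ≤-trans (≤-reflexive (sym (len-⟲ p q))) (D-greatest T (p ⟲ q) (⟲-path p q pp qq ¬s))

  𝓛≤len : ∀ {w x} (p : Walk T w x) → IsPath p → Central T w → 𝓛 T x ≤ len p
  𝓛≤len {w} {x} p pp cw = ≤-trans (𝓛≤D cw x) (≤-reflexive (trans (D-sym x w) (D≡len p pp)))

  -- On the path from `w` to `x` the vertex `b` is a neighbour of `w`, hence the second vertex;
  -- likewise `b′` for `y`. As `b ≢ b′`, the two paths diverge at `w` and join to the path from `x`
  -- to `y`.
  different⇒𝓛+𝓛≤D : ∀ {w} → Central T ≐ ｛ w ｝ → ∀ {x y} →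
    DifferentBranches T x y → 𝓛 T x + 𝓛 T y ≤ D T x y
  different⇒𝓛+𝓛≤D {w} C≐ {x} {y}
    (w₀ , b , b′ , (_ , cw₀ , w₀∼b) , (_ , _ , w₀∼b′) , b≢b′ ,
     (w₁ , (cw₁ , _) , p , pp , b∈p) , (w₂ , (cw₂ , _) , q , qq , b′∈q)) =
    go (proj₁ C≐ cw₀) (proj₁ C≐ cw₁) (proj₁ C≐ cw₂) (connected w x) (connected w y)
    where
    -- The branches and the two descents each name a central vertex; a one-vertex centre identifies
    -- all of them with `w`.
    go : w ≡ w₀ → w ≡ w₁ → w ≡ w₂ → Σ[ r ∈ Walk T w x ] IsPath r → Σ[ s ∈ Walk T w y ] IsPath s →
      𝓛 T x + 𝓛 T y ≤ D T x y
    go refl refl refl (r , rr) (s , ss) =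
      ≤-trans (+-mono-≤ (𝓛≤len r rr cw₀) (𝓛≤len s ss cw₀)) (⟲≤D r s rr ss diverge)
      where
      diverge : ∀ {z} → Starts z r → ¬ Starts z s
      diverge zr zs = b≢b′ (trans
        (starts-injective r (neighbour-starts r rr (on-path p pp b∈p r rr) (∼-sym w₀∼b)) zr)
        (starts-injective s zs (neighbour-starts s ss (on-path q qq b′∈q s ss) (∼-sym w₀∼b′))))

  -- If r started with w′, it would contain b whichever central vertex x descends
  -- from, and a neighbour of w on r is its second vertex, so b = w′ would be central.
  side-avoids : ∀ {w w′ x} → Central T ≐ ｛ w ｝ ∪ ｛ w′ ｝ → w ≢ w′ → OnSideOf T x w →
    (r : Walk T w x) → IsPath r → ¬ Starts w′ r
  side-avoids C≐ w≢w′ (cw , inj₁ refl) (e ∷ r) rr _ = contradiction (loop-empty (e ∷ r) rr) λ ()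
  side-avoids C≐ w≢w′ (cw , inj₂ (b , (¬cb , _ , w∼b) , (w₁ , (cw₁ , _) , p , pp , b∈p))) r@(e ∷ r′) rr@(_ ∷ rr′) refl
    = ¬cb (proj₂ C≐ (inj₂ (sym (neighbour-starts r rr (b∈r (proj₁ C≐ cw₁)) (∼-sym w∼b)))))
    where
    b∈r : _ ≡ w₁ ⊎ _ ≡ w₁ → b ∈ vertices r
    b∈r (inj₁ refl) = on-path p pp b∈p r rr
    b∈r (inj₂ refl) = there (on-path p pp b∈p r′ rr′)

  -- The path from `w′` to `y` avoids `w`, so the central edge can be put in front of it. The result
  -- diverges at `w` from the path to `x`, which avoids `w′`; the central edge accounts for the 1.
  sides⇒𝓛+𝓛+1≤D : ∀ {w w′} → Central T ≐ ｛ w ｝ ∪ ｛ w′ ｝ → w ≢ w′ → w ∼ w′ → ∀ {x y} →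
    OnSideOf T x w → OnSideOf T y w′ → 𝓛 T x + 𝓛 T y + 1 ≤ D T x y
  sides⇒𝓛+𝓛+1≤D {w} {w′} C≐ w≢w′ w∼w′ {x} {y} sx sy =
    go (connected w x) (connected w′ y)
    where
    go : Σ[ r ∈ Walk T w x ] IsPath r → Σ[ s ∈ Walk T w′ y ] IsPath s → 𝓛 T x + 𝓛 T y + 1 ≤ D T x y
    go (r , rr) (s , ss) =
      ≤-trans (+-monoˡ-≤ 1 (+-mono-≤ (𝓛≤len r rr (proj₁ sx)) (𝓛≤len s ss (proj₁ sy))))
        (≤-trans (≤-reflexive (trans (+-assoc (len r) (len s) 1) (cong (λ k → len r + k) (+-comm (len s) 1))))
          (⟲≤D r (w∼w′ ∷ s) rr
            (extend w∼w′ s ss (side-avoids (C≐-swap C≐) (≢-sym w≢w′) sy s ss))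
            (λ { zr refl → side-avoids C≐ w≢w′ sx r rr zr })))
      where
      C≐-swap : ∀ {a b} → Central T ≐ ｛ a ｝ ∪ ｛ b ｝ → Central T ≐ ｛ b ｝ ∪ ｛ a ｝
      C≐-swap (to , from) = (λ c → swap (to c)) , (λ m → from (swap m))

  opposite⇒𝓛+𝓛+1≤D : ∀ {w w′} → Central T ≐ ｛ w ｝ ∪ ｛ w′ ｝ → w ≢ w′ → w ∼ w′ → ∀ {x y} →
    OppositeBranches T x y → 𝓛 T x + 𝓛 T y + 1 ≤ D T x y
  opposite⇒𝓛+𝓛+1≤D {w} {w′} C≐ w≢w′ w∼w′ {x} {y} (a , a′ , a≢a′ , sx , sy) =
    go sx sy (proj₁ C≐ (proj₁ sx)) (proj₁ C≐ (proj₁ sy))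
    where
    go : OnSideOf T x a → OnSideOf T y a′ → w ≡ a ⊎ w′ ≡ a → w ≡ a′ ⊎ w′ ≡ a′ →
      𝓛 T x + 𝓛 T y + 1 ≤ D T x y
    go _  _  (inj₁ refl) (inj₁ refl) = contradiction refl a≢a′
    go sx sy (inj₁ refl) (inj₂ refl) = sides⇒𝓛+𝓛+1≤D C≐ w≢w′ w∼w′ sx sy
    go sx sy (inj₂ refl) (inj₁ refl) = ≤-trans (≤-reflexive (cong (_+ 1) (+-comm (𝓛 T x) (𝓛 T y))))
      (≤-trans (sides⇒𝓛+𝓛+1≤D C≐ w≢w′ w∼w′ sy sx) (≤-reflexive (D-sym y x)))
    go _  _  (inj₂ refl) (inj₂ refl) = contradiction refl a≢a′

  ε≤1 : Centre → ε T ≤ 1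
  ε≤1 (one _ _ ε≡0)       = ≤-trans (≤-reflexive ε≡0) z≤n
  ε≤1 (two _ _ _ _ _ ε≡1) = ≤-reflexive ε≡1

  -- A vertex of level 0 is central, so with a single centre two distinct vertices cannot both have
  -- level 0; with two centres `ε′ T` is 0.
  ε′≤𝓛+𝓛 : Centre → ∀ {x y} → x ≢ y → ε′ T ≤ 𝓛 T x + 𝓛 T y
  ε′≤𝓛+𝓛 (two _ _ _ _ _ ε≡1) x≢y = ≤-trans (≤-reflexive (cong (1 ∸_) ε≡1)) z≤n
  ε′≤𝓛+𝓛 (one _ C≐ ε≡0) {x} {y} x≢y =
    ≤-trans (≤-reflexive (cong (1 ∸_) ε≡0)) (n≢0⇒n>0 λ 𝓛+𝓛≡0 →
      x≢y (trans (sym (proj₁ C≐ (𝓛≡0⇒central {x} (m+n≡0⇒m≡0 (𝓛 T x) 𝓛+𝓛≡0))))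
                 (proj₁ C≐ (𝓛≡0⇒central {y} (m+n≡0⇒n≡0 (𝓛 T x) 𝓛+𝓛≡0)))))

-- Telescoping sums along a list.

module _ {A : Set} where

  final : A → List A → A
  final x []       = x
  final _ (y ∷ ys) = final y ys

  final∈ : ∀ x (xs : List A) → final x xs ∈ x ∷ xs
  final∈ x []       = here refl
  final∈ x (y ∷ ys) = there (final∈ y ys)

  unique⇒head≢final : ∀ {x} {xs : List A} → Unique (x ∷ xs) → 1 ≤ length xs → x ≢ final x xs
  unique⇒head≢final {xs = y ∷ ys} (x∉ ∷ _) _ x≡ = All.lookup x∉ (final∈ y ys) x≡

  final-tabulate : ∀ {m} (f : Fin (suc m) → A) l → toℕ l ≡ m →
    final (f zero) (tabulate (λ i → f (suc i))) ≡ f l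
  final-tabulate {zero}  f zero    _  = refl
  final-tabulate {suc m} f (suc l) eq = final-tabulate (λ i → f (suc i)) l (suc-injective eq)

  linked-tabulate : ∀ {R : A → A → Set} {n} (f : Fin n → A) →
    (∀ i j → toℕ j ≡ suc (toℕ i) → R (f i) (f j)) → Linked R (tabulate f)
  linked-tabulate {n = zero}        f _ = []
  linked-tabulate {n = suc zero}    f _ = [-]
  linked-tabulate {n = suc (suc n)} f r =
    r zero (suc zero) refl ∷ linked-tabulate (λ i → f (suc i)) (λ i j eq → r (suc i) (suc j) (cong suc eq))

  -- Used with ≤ for an arbitrary colouring and with ≡ for the given one.
  telescope : ∀ {_≲_ : ℕ → ℕ → Set} → IsPreorder _≡_ _≲_ → Congruent₂ _≲_ _+_ →
    ∀ (c L : A → ℕ) a x xs → Linked (λ y z → (a + c y) ≲ (L y + L z + c z)) (x ∷ xs) →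
    (length xs * a + c x + (L x + L (final x xs))) ≲ (2 * sum (map L (x ∷ xs)) + c (final x xs))
  telescope {_≲_} pre mono c L a x [] [-] = IsPreorder.reflexive pre (base (c x) (L x))
    where
    base : ∀ k l → k + (l + l) ≡ 2 * (l + 0) + k
    base = solve-∀
  telescope {_≲_} pre mono c L a x (y ∷ ys) (r ∷ rs) =
    P.trans (P.reflexive (regroupˡ (length ys) a (c x) (L x) (L (final y ys))))
      (P.trans (mono (mono r (P.refl {L x})) (P.refl {length ys * a + L (final y ys)}))
        (P.trans (P.reflexive (regroupᵐ (length ys) a (c y) (L x) (L y) (L (final y ys))))
          (P.trans (mono (P.refl {2 * L x}) (telescope pre mono c L a y ys rs))
            (P.reflexive (regroupʳ (L x) (sum (map L (y ∷ ys))) (c (final y ys)))))))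
    where
    module P = IsPreorder pre
    regroupˡ : ∀ k a cx lx l → suc k * a + cx + (lx + l) ≡ (a + cx) + lx + (k * a + l)
    regroupˡ = solve-∀
    regroupᵐ : ∀ k a cy lx ly l →
      (lx + ly + cy) + lx + (k * a + l) ≡ 2 * lx + (k * a + cy + (ly + l))
    regroupᵐ = solve-∀
    regroupʳ : ∀ lx s k → 2 * lx + (2 * s + k) ≡ 2 * (lx + s) + k
    regroupʳ = solve-∀

-- The equality case for an enumeration. Each inner `L` enters two consecutive gaps and each end
-- only one, so the end terms on the left complete the doubled sum.
telescope-tabulate : ∀ {n m} {A : Set} (u : Fin n → A) (c L : A → ℕ) a → n ≡ suc m →
  (∀ i j → toℕ j ≡ suc (toℕ i) → a + c (u i) ≡ L (u i) + L (u j) + c (u j)) →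
  ∀ i l → toℕ i ≡ 0 → suc (toℕ l) ≡ n →
  m * a + c (u i) + (L (u i) + L (u l)) ≡ 2 * sum (map L (tabulate u)) + c (u l)
telescope-tabulate {m = m} u c L a refl step zero l _ l≡m =
  subst₂ (λ k z → k * a + c (u zero) + (L (u zero) + L z) ≡ 2 * sum (map L (tabulate u)) + c z)
    (length-tabulate (λ i → u (suc i))) (final-tabulate u l (suc-injective l≡m))
    (telescope ≡-isPreorder (cong₂ _+_) c L a (u zero) (tabulate (λ i → u (suc i))) (linked-tabulate u step))

complete-unique⇒↭ : ∀ {n} {xs : List (Fin n)} → Unique xs → (∀ v → v ∈ xs) → xs ↭ allFin n
complete-unique⇒↭ {n} xs! all∈ =
  ∼bag⇒↭ (unique∧set⇒bag xs! (Unique.allFin⁺ n) (mk⇔ (λ _ → ∈-allFin _) (λ _ → all∈ _)))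

increasing : ∀ {n} (g : Fin n → ℕ) → (∀ i j → toℕ j ≡ suc (toℕ i) → g i ≤ g j) →
  ∀ i j → toℕ i ≤ toℕ j → g i ≤ g j
increasing g s zero    zero    _ = ≤-refl
increasing {suc (suc n)} g s zero (suc j) _ = ≤-trans (s zero (suc zero) refl)
  (increasing (λ i → g (suc i)) (λ i j eq → s (suc i) (suc j) (cong suc eq)) zero j z≤n)
increasing g s (suc i) (suc j) (s≤s i≤j) =
  increasing (λ i → g (suc i)) (λ i j eq → s (suc i) (suc j) (cong suc eq)) i j i≤j

c≤maxColor : ∀ {n} (c : Fin n → ℕ) v → c v ≤ maxColor c
c≤maxColor c v = All.lookup (xs≤max 0 _) (∈-map⁺ c (∈-allFin v))

-- Lower bound for all hamiltonian colourings.

-- δ, ℓ, e, e′ stand for D T, 𝓛 T, ε T, ε′ T, kept variable so that they do not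
-- unfold into path enumerations.
module Levelled {n m : ℕ} (n≡1+m : n ≡ suc m) (1≤m : 1 ≤ m)
  (δ : Fin n → Fin n → ℕ) (ℓ : Fin n → ℕ) (e e′ : ℕ)
  (δ-sym : ∀ x y → δ x y ≡ δ y x)
  (≢⇒1≤δ : ∀ {x y} → x ≢ y → 1 ≤ δ x y)
  (δ≤ℓ+ℓ+e : ∀ x y → δ x y ≤ ℓ x + ℓ y + e)
  (e≤1 : e ≤ 1)
  (e′≤ℓ+ℓ : ∀ {x y} → x ≢ y → e′ ≤ ℓ x + ℓ y)
  where

  Hamiltonian : (Fin n → ℕ) → Set
  Hamiltonian c = ∀ x y → x ≢ y → m ≤ δ x y + ∣ c x - c y ∣

  total : ℕ
  total = sum (map ℓ (allFin n))

  m∸e+e≡m : m ∸ e + e ≡ m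
  m∸e+e≡m = m∸n+n≡m (≤-trans e≤1 1≤m)

  -- The term `2 * total`, subtracted in the closed formula, stands on the right so that the bound
  -- stays within the naturals.
  maxColor-lower-bound : ∀ c → Hamiltonian c →
    m * (m ∸ e) + e′ ≤ 2 * total + maxColor c
  maxColor-lower-bound c ham =
    go (sort (allFin n)) (sort-↭ (allFin n)) (sort-↗ (allFin n))
    where
    open Sort (On.decTotalOrder ≤-decTotalOrder c)

    step : ∀ {x y} → c x ≤ c y × x ≢ y → m ∸ e + c x ≤ ℓ x + ℓ y + c y
    step {x} {y} (cx≤cy , x≢y) = +-cancelʳ-≤ e _ _ (begin
      m ∸ e + c x + e              ≡⟨ +-swapʳ (m ∸ e) (c x) e ⟩
      m ∸ e + e + c x              ≡⟨ cong (_+ c x) m∸e+e≡m ⟩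
      m + c x                      ≤⟨ +-monoˡ-≤ (c x) (ham x y x≢y) ⟩
      δ x y + ∣ c x - c y ∣ + c x  ≡⟨ cong (λ k → δ x y + k + c x) (m≤n⇒∣m-n∣≡n∸m cx≤cy) ⟩
      δ x y + (c y ∸ c x) + c x    ≡⟨ +-assoc (δ x y) _ _ ⟩
      δ x y + (c y ∸ c x + c x)    ≡⟨ cong (λ k → δ x y + k) (m∸n+n≡m cx≤cy) ⟩
      δ x y + c y                  ≤⟨ +-monoˡ-≤ (c y) (δ≤ℓ+ℓ+e x y) ⟩
      ℓ x + ℓ y + e + c y          ≡⟨ +-swapʳ (ℓ x + ℓ y) e (c y) ⟩
      ℓ x + ℓ y + c y + e          ∎)
      where open ≤-Reasoning

    go : ∀ xs → xs ↭ allFin n → Linked (λ x y → c x ≤ c y) xs →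
      m * (m ∸ e) + e′ ≤ 2 * total + maxColor c
    go [] xs↭ _ = contradiction (trans (↭-length xs↭) (trans (length-tabulate {n = n} (λ i → i)) n≡1+m)) λ ()
    go (x ∷ xs) xs↭ sorted = begin
      m * (m ∸ e) + e′
        -- The list has `m + 1` entries with `1 ≤ m`, so its two ends are distinct vertices.
        ≤⟨ +-monoʳ-≤ (m * (m ∸ e)) (e′≤ℓ+ℓ (unique⇒head≢final xs! (subst (1 ≤_) (sym length≡m) 1≤m))) ⟩
      m * (m ∸ e) + (ℓ x + ℓ (final x xs))
        -- The least colour `c x` may be positive; it enters on the larger side.
        ≤⟨ +-monoˡ-≤ (ℓ x + ℓ (final x xs)) (m≤m+n (m * (m ∸ e)) (c x)) ⟩
      m * (m ∸ e) + c x + (ℓ x + ℓ (final x xs))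
        ≡⟨ cong (λ k → k * (m ∸ e) + c x + (ℓ x + ℓ (final x xs))) length≡m ⟨
      length xs * (m ∸ e) + c x + (ℓ x + ℓ (final x xs))
        ≤⟨ telescope ≤-isPreorder +-mono-≤ c ℓ (m ∸ e) x xs
             (Linked.zipWith step (sorted , AllPairs⇒Linked xs!)) ⟩
      2 * sum (map ℓ (x ∷ xs)) + c (final x xs)
        ≡⟨ cong (λ k → 2 * k + c (final x xs)) (sum-↭ (map⁺ ℓ xs↭)) ⟩
      2 * total + c (final x xs)
        ≤⟨ +-monoʳ-≤ (2 * total) (c≤maxColor c (final x xs)) ⟩
      2 * total + maxColor c ∎
      where
      open ≤-Reasoning
      xs! : Unique (x ∷ xs)
      xs! = Unique-resp-↭ (setoid _) (↭⇒↭ₛ (↭-sym xs↭)) (Unique.allFin⁺ n)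
      length≡m : length xs ≡ m
      length≡m = suc-injective (trans (↭-length xs↭) (trans (length-tabulate {n = n} (λ i → i)) n≡1+m))

  -- The colouring given by the linear order.

  module Ordered
    (u : Fin n → Fin n) (u-bij : Bijective _≡_ _≡_ u)
    (c : Fin n → ℕ)
    (c-step : ∀ i j → toℕ j ≡ suc (toℕ i) →
      m + c (u i) ≡ ℓ (u i) + ℓ (u j) + c (u j) + e)
    (c-increases : ∀ i j → toℕ j ≡ suc (toℕ i) → c (u i) < c (u j))
    (far : ∀ i j → toℕ j ≡ suc (toℕ i) → ℓ (u i) + ℓ (u j) + e ≤ δ (u i) (u j))
    (near : ∀ i j → toℕ j ≡ suc (toℕ i) → 2 * δ (u i) (u j) ≤ n)
    where

    index : ∀ v → ∃[ i ] u i ≡ v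
    index v with proj₂ u-bij v
    ... | i , eq = i , eq refl

    c-monotone : ∀ i j → toℕ i ≤ toℕ j → c (u i) ≤ c (u j)
    c-monotone = increasing (λ i → c (u i)) (λ i j eq → <⇒≤ (c-increases i j eq))

    -- The colour rises by `m` less the two levels and `e`; by `far` the distance makes up for what
    -- was subtracted.
    gap : ∀ i j → toℕ j ≡ suc (toℕ i) → m + c (u i) ≤ δ (u i) (u j) + c (u j)
    gap i j eq = begin
      m + c (u i)                      ≡⟨ c-step i j eq ⟩
      ℓ (u i) + ℓ (u j) + c (u j) + e  ≡⟨ +-swapʳ (ℓ (u i) + ℓ (u j)) (c (u j)) e ⟩
      ℓ (u i) + ℓ (u j) + e + c (u j)  ≤⟨ +-monoˡ-≤ (c (u j)) (far i j eq) ⟩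
      δ (u i) (u j) + c (u j)          ∎
      where open ≤-Reasoning

    -- By `near` a distance is at most `(m + 1) / 2`, so a consecutive gap is at least
    -- `m - (m + 1) / 2 = (m - 1) / 2`; everything is doubled to avoid halves.
    half-gap : ∀ i j → toℕ j ≡ suc (toℕ i) → m + 2 * c (u i) ≤ 1 + 2 * c (u j)
    half-gap i j eq = +-cancelˡ-≤ m _ _ (begin
      m + (m + 2 * c (u i))            ≡⟨ double m (c (u i)) ⟩
      2 * (m + c (u i))                ≤⟨ *-monoʳ-≤ 2 (gap i j eq) ⟩
      2 * (δ (u i) (u j) + c (u j))    ≡⟨ *-distribˡ-+ 2 (δ (u i) (u j)) (c (u j)) ⟩
      2 * δ (u i) (u j) + 2 * c (u j)  ≤⟨ +-monoˡ-≤ (2 * c (u j)) (near i j eq) ⟩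
      n + 2 * c (u j)                  ≡⟨ cong (_+ 2 * c (u j)) n≡1+m ⟩
      suc m + 2 * c (u j)              ≡⟨ +-suc m (2 * c (u j)) ⟨
      m + (1 + 2 * c (u j))            ∎)
      where
      open ≤-Reasoning
      double : ∀ a b → a + (a + 2 * b) ≡ 2 * (a + b)
      double = solve-∀

    -- Adding two half-gaps cancels the middle colour and leaves a rise of at least `m - 1`. The
    -- missing unit will come from the distance between distinct vertices.
    two-gaps : ∀ i k j → toℕ k ≡ suc (toℕ i) → toℕ j ≡ suc (toℕ k) → m + c (u i) ≤ 1 + c (u j)
    two-gaps i k j i→k k→j = *-cancelˡ-≤ 2 (+-cancelʳ-≤ (2 * c (u k)) _ _ (begin
      2 * (m + c (u i)) + 2 * c (u k)        ≡⟨ splitˡ m (c (u i)) (c (u k)) ⟩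
      (m + 2 * c (u i)) + (m + 2 * c (u k))  ≤⟨ +-mono-≤ (half-gap i k i→k) (half-gap k j k→j) ⟩
      (1 + 2 * c (u k)) + (1 + 2 * c (u j))  ≡⟨ splitʳ (c (u j)) (c (u k)) ⟩
      2 * (1 + c (u j)) + 2 * c (u k)        ∎))
      where
      open ≤-Reasoning
      splitˡ : ∀ a b d → 2 * (a + b) + 2 * d ≡ (a + 2 * b) + (a + 2 * d)
      splitˡ = solve-∀
      splitʳ : ∀ b d → (1 + 2 * d) + (1 + 2 * b) ≡ 2 * (1 + b) + 2 * d
      splitʳ = solve-∀

    next : ∀ (i j : Fin n) → toℕ i < toℕ j → ∃[ k ] toℕ k ≡ suc (toℕ i) × toℕ k ≤ toℕ j
    next i j i<j = fromℕ< i+1<n , toℕ-fromℕ< i+1<n , ≤-trans (≤-reflexive (toℕ-fromℕ< i+1<n)) i<j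
      where
      i+1<n : suc (toℕ i) < n
      i+1<n = ≤-<-trans i<j (toℕ<n j)

    -- Consecutive indices use `gap`. Otherwise the first two steps from `i` already raise the
    -- colour by `m - 1`, monotonicity carries this on to `j`, and the distance supplies at least 1.
    separated : ∀ i j → toℕ i < toℕ j → m + c (u i) ≤ δ (u i) (u j) + c (u j)
    separated i j i<j with next i j i<j
    ... | k , i→k , k≤j with m≤n⇒m<n∨m≡n k≤j
    ...   | inj₂ k≡j = gap i j (trans (sym k≡j) i→k)
    ...   | inj₁ k<j with next k j k<j
    ...     | l , k→l , l≤j = begin
      m + c (u i)              ≤⟨ two-gaps i k l i→k k→l ⟩
      1 + c (u l)              ≤⟨ +-mono-≤ (≢⇒1≤δ ui≢uj) (c-monotone l j l≤j) ⟩
      δ (u i) (u j) + c (u j)  ∎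
      where
      open ≤-Reasoning
      ui≢uj : u i ≢ u j
      ui≢uj ui≡uj = <⇒≢ i<j (cong toℕ (proj₁ u-bij ui≡uj))

    hamiltonian-< : ∀ i j → toℕ i < toℕ j → m ≤ δ (u i) (u j) + ∣ c (u i) - c (u j) ∣
    hamiltonian-< i j i<j = +-cancelʳ-≤ (c (u i)) _ _ (begin
      m + c (u i)                                        ≤⟨ separated i j i<j ⟩
      δ (u i) (u j) + c (u j)                            ≤⟨ +-monoʳ-≤ (δ (u i) (u j)) (m≤∣m-n∣+n (c (u j)) (c (u i))) ⟩
      δ (u i) (u j) + (∣ c (u j) - c (u i) ∣ + c (u i))  ≡⟨ +-assoc (δ (u i) (u j)) _ _ ⟨
      δ (u i) (u j) + ∣ c (u j) - c (u i) ∣ + c (u i)    ≡⟨ cong (λ k → δ (u i) (u j) + k + c (u i)) (∣-∣-comm (c (u j)) (c (u i))) ⟩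
      δ (u i) (u j) + ∣ c (u i) - c (u j) ∣ + c (u i)    ∎)
      where open ≤-Reasoning

    hamiltonian : Hamiltonian c
    hamiltonian x y x≢y with index x | index y
    ... | i , refl | j , refl with <-cmp (toℕ i) (toℕ j)
    ...   | tri< i<j _ _ = hamiltonian-< i j i<j
    ...   | tri≈ _ i≡j _ = contradiction (cong u (toℕ-injective i≡j)) x≢y
    ...   | tri> _ _ j<i = subst (m ≤_)
      (cong₂ _+_ (δ-sym (u j) (u i)) (∣-∣-comm (c (u j)) (c (u i)))) (hamiltonian-< j i j<i)

    maxColor≡c-last : ∀ l → suc (toℕ l) ≡ n → maxColor c ≡ c (u l)
    maxColor≡c-last l l≡n = ≤-antisym
      (max≤v⁺ {xs = map c (allFin n)} z≤n (All.map⁺ (All.tabulate λ {v} _ → below v))) (c≤maxColor c (u l))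
      where
      below : ∀ v → c v ≤ c (u l)
      below v with index v
      ... | i , refl = c-monotone i l (s≤s⁻¹ (subst (toℕ i <_) (sym l≡n) (toℕ<n i)))

    -- The recursion makes every consecutive estimate an equality, so the telescoped sum is exact;
    -- bijectivity of `u` turns the sum along the order into `total`.
    c-last : ∀ i l → toℕ i ≡ 0 → suc (toℕ l) ≡ n →
      m * (m ∸ e) + c (u i) + (ℓ (u i) + ℓ (u l)) ≡ 2 * total + c (u l)
    c-last i l i≡0 l≡n = trans
      (telescope-tabulate u c ℓ (m ∸ e) n≡1+m step i l i≡0 l≡n)
      (cong (λ s → 2 * s + c (u l)) (sum-↭ (map⁺ ℓ u↭)))
      where
      step : ∀ i j → toℕ j ≡ suc (toℕ i) → m ∸ e + c (u i) ≡ ℓ (u i) + ℓ (u j) + c (u j)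
      step i j eq = +-cancelʳ-≡ e _ _ (begin
        m ∸ e + c (u i) + e              ≡⟨ +-swapʳ (m ∸ e) (c (u i)) e ⟩
        m ∸ e + e + c (u i)              ≡⟨ cong (_+ c (u i)) m∸e+e≡m ⟩
        m + c (u i)                      ≡⟨ c-step i j eq ⟩
        ℓ (u i) + ℓ (u j) + c (u j) + e  ∎)
        where open ≡-Reasoning
      u↭ : tabulate u ↭ allFin n
      u↭ = complete-unique⇒↭ (Unique.tabulate⁺ (proj₁ u-bij)) λ v →
        subst (_∈ tabulate u) (proj₂ (index v)) (∈-tabulate⁺ (proj₁ (index v)))

-- Between integer formulas and natural numbers.

-- The recursion is posed over the integers, where subtraction is not truncated; moving the
-- subtracted terms across makes it an equation of naturals.
clear-differences : ∀ {n m a b l l′ e} → n ≡ suc m →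
  + b ≡ + a ℤ.+ + n ℤ.- + 1 ℤ.- + l ℤ.- + l′ ℤ.- + e → m + a ≡ l + l′ + b + e
clear-differences {_} {m} {a} {b} {l} {l′} {e} refl eq = +-injective (trans
  (identity (+ m) (+ a) (+ l) (+ l′) (+ e)) (cong (λ k → + l ℤ.+ + l′ ℤ.+ k ℤ.+ + e) (sym eq)))
  where
  identity : ∀ m a l l′ e → m ℤ.+ a ≡
    l ℤ.+ l′ ℤ.+ (a ℤ.+ (+ 1 ℤ.+ m) ℤ.- + 1 ℤ.- l ℤ.- l′ ℤ.- e) ℤ.+ e
  identity = ℤ-Solver.solve-∀

-- Here `k` is `m ∸ e`, described by `k + e ≡ m` so that it agrees with the integer difference.
solve-for-h : ∀ {n m k e e′ s h} → n ≡ suc m → k + e ≡ m → m * k + e′ ≡ 2 * s + h →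
  + h ≡ (+ n ℤ.- + 1) ℤ.* (+ n ℤ.- + 1 ℤ.- + e) ℤ.+ + e′ ℤ.- + 2 ℤ.* + s
solve-for-h {_} {_} {k} {e} {e′} {s} {h} refl refl eq = begin
  + h
    ≡⟨ cancel (+ 2 ℤ.* + s) (+ h) ⟩
  + 2 ℤ.* + s ℤ.+ + h ℤ.- + 2 ℤ.* + s
    ≡⟨ cong (λ t → t ℤ.+ + h ℤ.- + 2 ℤ.* + s) (pos-* 2 s) ⟨
  + (2 * s + h) ℤ.- + 2 ℤ.* + s
    ≡⟨ cong (λ t → + t ℤ.- + 2 ℤ.* + s) eq ⟨
  + ((k + e) * k) ℤ.+ + e′ ℤ.- + 2 ℤ.* + s
    ≡⟨ cong (λ t → t ℤ.+ + e′ ℤ.- + 2 ℤ.* + s) (pos-* (k + e) k) ⟩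
  (+ k ℤ.+ + e) ℤ.* + k ℤ.+ + e′ ℤ.- + 2 ℤ.* + s
    ≡⟨ expand (+ k) (+ e) (+ e′) (+ 2 ℤ.* + s) ⟩
  (+ suc (k + e) ℤ.- + 1) ℤ.* (+ suc (k + e) ℤ.- + 1 ℤ.- + e) ℤ.+ + e′ ℤ.- + 2 ℤ.* + s ∎
  where
  open ≡-Reasoning
  cancel : ∀ t h → h ≡ t ℤ.+ h ℤ.- t
  cancel = ℤ-Solver.solve-∀
  expand : ∀ k e e′ t → (k ℤ.+ e) ℤ.* k ℤ.+ e′ ℤ.- t ≡
    (+ 1 ℤ.+ (k ℤ.+ e) ℤ.- + 1) ℤ.* (+ 1 ℤ.+ (k ℤ.+ e) ℤ.- + 1 ℤ.- e) ℤ.+ e′ ℤ.- t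
  expand = ℤ-Solver.solve-∀

-- The hamiltonian chromatic number and an optimal colouring.

theorem5 :
  ∀ {n : ℕ} (T : Graph n) → IsTree T → 4 ≤ n → 3 ≤ Δ T →
  (u : Fin n → Fin n) → Bijective _≡_ _≡_ u →
  (first last : Fin n) → toℕ first ≡ 0 → suc (toℕ last) ≡ n →
  (c : Fin n → ℕ) →
  c (u first) ≡ 0 →
  (∀ i j → toℕ j ≡ suc (toℕ i) →
    + c (u j) ≡ + c (u i) ℤ.+ + n ℤ.- + 1 ℤ.- + 𝓛 T (u i) ℤ.- + 𝓛 T (u j) ℤ.- + ε T) →
  (∀ i j → toℕ j ≡ suc (toℕ i) → c (u i) < c (u j)) →
  (∀ w → Central T ≐ ｛ w ｝ → u first ≡ w × N T w (u last)) →
  (∀ w w′ → w ≢ w′ → Central T ≐ ｛ w ｝ ∪ ｛ w′ ｝ →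
    ｛ u first ｝ ∪ ｛ u last ｝ ≐ ｛ w ｝ ∪ ｛ w′ ｝) →
  (∀ w → Central T ≐ ｛ w ｝ →
    ∀ i j → 1 ≤ toℕ i → toℕ j ≡ suc (toℕ i) → DifferentBranches T (u i) (u j)) →
  (∀ w w′ → w ≢ w′ → Central T ≐ ｛ w ｝ ∪ ｛ w′ ｝ →
    ∀ i j → toℕ j ≡ suc (toℕ i) → OppositeBranches T (u i) (u j)) →
  (∀ i j → toℕ j ≡ suc (toℕ i) → 2 * D T (u i) (u j) ≤ n) →
  ∃[ h ] HasHC T h
       × + h ≡ (+ n ℤ.- + 1) ℤ.* (+ n ℤ.- + 1 ℤ.- + ε T) ℤ.+ + ε′ T ℤ.- + 2 ℤ.* + 𝓛-total T
       × IsHamiltonianColoring T c × maxColor c ≡ h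
theorem5 {n} T tree 4≤n _ u u-bij first last first≡ last≡ c c₀≡0 c-eq c-increases ends₁ ends₂ branches₁ branches₂ near =
  -- Colours increase along the order, so the last vertex carries the maximum.
  c (u last) ,
  ((c , hamiltonian , max≡) ,
   -- The lower bound for `c′` and the exact value for `c` share the same left-hand side; cancelling
   -- `2 * 𝓛-total T` compares the two maxima.
   λ c′ ham′ → +-cancelˡ-≤ (2 * 𝓛-total T) _ _
     (≤-trans (≤-reflexive (sym c-last≡)) (maxColor-lower-bound c′ ham′))) ,
  solve-for-h {s = 𝓛-total T} n≡1+m m∸e+e≡m c-last≡ , hamiltonian , max≡
  where
  open Tree T tree

  centre-shape : Centre
  centre-shape = classify first

  n≡1+m : n ≡ suc (n ∸ 1)
  n≡1+m = sym (m+[n∸m]≡n (≤-trans (s≤s z≤n) 4≤n))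

  open Levelled n≡1+m (∸-monoˡ-≤ {2} 1 (≤-trans (s≤s (s≤s z≤n)) 4≤n))
    (D T) (𝓛 T) (ε T) (ε′ T) D-sym ≢⇒1≤D D≤𝓛+𝓛+ε (ε≤1 centre-shape) (ε′≤𝓛+𝓛 centre-shape)
    hiding (total)

  -- The prescribed ends attain the bound `ε′≤𝓛+𝓛`: their levels are 0 and 1 for one central vertex,
  -- and both 0 for two.
  ends : Centre → 𝓛 T (u first) + 𝓛 T (u last) ≡ ε′ T
  ends (one w C≐ ε≡0) =
    trans (cong₂ _+_ (𝓛-central {u first} (proj₂ C≐ (sym (proj₁ (ends₁ w C≐))))) 𝓛≡1) (cong (1 ∸_) (sym ε≡0))
    where
    w∼ : Graph._∼_ T w (u last)
    w∼ = proj₂ (ends₁ w C≐)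
    𝓛≡1 : 𝓛 T (u last) ≡ 1
    𝓛≡1 = ≤-antisym
      (≤-trans (𝓛≤D (proj₂ C≐ refl) (u last)) (≤-reflexive (trans (D-sym (u last) w) (D-adjacent w∼))))
      -- Level 0 would make `u last` equal to `w`, which is not adjacent to itself.
      (n≢0⇒n>0 λ 𝓛≡0 → Graph.∼-irrefl T (proj₁ C≐ (𝓛≡0⇒central {u last} 𝓛≡0)) w∼)
  ends (two w w′ w≢w′ _ C≐ ε≡1) = trans
    (cong₂ _+_ (𝓛-central {u first} (central (inj₁ refl))) (𝓛-central {u last} (central (inj₂ refl))))
    (cong (1 ∸_) (sym ε≡1))
    where
    central : ∀ {x} → (｛ u first ｝ ∪ ｛ u last ｝) x → Central T x
    central x∈ = proj₂ C≐ (proj₁ (ends₂ w w′ w≢w′ C≐) x∈)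

  -- The converse of `D≤𝓛+𝓛+ε` for consecutive vertices, which is what the branch conditions
  -- provide.
  far : Centre → ∀ i j → toℕ j ≡ suc (toℕ i) → 𝓛 T (u i) + 𝓛 T (u j) + ε T ≤ D T (u i) (u j)
  far (two w w′ w≢w′ w∼w′ C≐ ε≡1) i j eq =
    ≤-trans (≤-reflexive (cong (λ k → 𝓛 T (u i) + 𝓛 T (u j) + k) ε≡1))
      (opposite⇒𝓛+𝓛+1≤D C≐ w≢w′ w∼w′ (branches₂ w w′ w≢w′ C≐ i j eq))
  far (one w C≐ ε≡0) i j eq =
    ≤-trans (≤-reflexive (trans (cong (λ k → 𝓛 T (u i) + 𝓛 T (u j) + k) ε≡0) (+-identityʳ _)))
      (go (m≤n⇒m<n∨m≡n z≤n))
    where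
    go : 1 ≤ toℕ i ⊎ 0 ≡ toℕ i → 𝓛 T (u i) + 𝓛 T (u j) ≤ D T (u i) (u j)
    go (inj₁ 1≤i) = different⇒𝓛+𝓛≤D C≐ (branches₁ w C≐ i j 1≤i eq)
    -- The first vertex is the centre and lies in no branch; its level is 0, and the level of `u j`
    -- is at most its distance to the centre.
    go (inj₂ 0≡i) = ≤-trans (≤-reflexive (cong (_+ 𝓛 T (u j)) (𝓛-central {u i} central)))
      (≤-trans (𝓛≤D central (u j)) (≤-reflexive (D-sym (u j) (u i))))
      where
      central : Central T (u i)
      central = proj₂ C≐ (sym (trans (cong u (toℕ-injective (trans (sym 0≡i) (sym first≡)))) (proj₁ (ends₁ w C≐))))

  open Ordered u u-bij c (λ i j eq → clear-differences n≡1+m (c-eq i j eq)) c-increases (far centre-shape) near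

  max≡ : maxColor c ≡ c (u last)
  max≡ = maxColor≡c-last last last≡

  c-last≡ : (n ∸ 1) * (n ∸ 1 ∸ ε T) + ε′ T ≡ 2 * 𝓛-total T + c (u last)
  c-last≡ = trans
    (cong₂ _+_ (sym (trans (cong (λ k → (n ∸ 1) * (n ∸ 1 ∸ ε T) + k) c₀≡0) (+-identityʳ _)))
               (sym (ends centre-shape)))
    (c-last first last first≡ last≡)
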